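{- Let $n=p_1^{\alpha_1}\cdots p_k^{\alpha_k}$, where $k\geq 1$, $\alpha_i\geq 1$ and the $p_i$ are distinct primes satisfying $p_i\equiv 1\pmod 4$ for all $i=1,\ldots,k$. Then: (1) if $p_i=5$ for some $i\in\{1,\ldots,k\}$, then the clique number of the Paley-type graph $G_n$ is $2$; and (2) if $p_i\in\{13,17\}$ for some $i\in\{1,\ldots,k\}$ and $5\nmid n$, then the clique number of $G_n$ is $3$.
   Context: For $n=p_1^{\alpha_1}\cdots p_k^{\alpha_k}$ with distinct primes $p_i\equiv 1\pmod 4$ and $\alpha_i\ge 1$, let $\mathbb{Z}_n^\ast$ be the group of units of the ring $\mathbb{Z}_n=\mathbb{Z}/n\mathbb{Z}$. The Paley-type graph $G_n$ is the simple undirected graph with vertex set $\mathbb{Z}_n$ in which $xy$ is an edge if and only if $x-y\equiv a^2\pmod n$ for some $a\in\mathbb{Z}_n^\ast$ (this is symmetric since $-1$ is a square in $\mathbb{Z}_n^\ast$). The clique number of a graph is the order of a clique of maximum size contained in the graph. -}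

module Defs where

open import Data.Fin using (Fin; toℕ)
open import Data.Fin.Subset using (Subset; _∈_; ∣_∣)
open import Data.Integer using (ℤ; +_; _-_; _*_; 1ℤ)
open import Data.Integer.Divisibility.Signed using (_∣_)
open import Data.List using (tabulate)
open import Data.Nat using (ℕ; _≤_; _^_)
open import Data.Nat.ListAction using (product)
open import Data.Product using (_×_; ∃-syntax)
open import Level using (0ℓ)
open import Relation.Binary using (Rel)
open import Relation.Binary.PropositionalEquality using (_≡_; _≢_)

primePowerProduct : ∀ {k} → (Fin k → ℕ) → (Fin k → ℕ) → ℕ
primePowerProduct p α = product (tabulate λ i → p i ^ α i)

infix 4 _≋_[mod_]

_≋_[mod_] : ℤ → ℤ → ℕ → Set
i ≋ j [mod n ] = + n ∣ i - j

-- ℤₙ is represented by Fin n, each residue class by its least non-negative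
-- member; the ring operations are those of ℤ, read modulo n.
rep : ∀ {n} → Fin n → ℤ
rep x = + toℕ x

IsUnit : ∀ {n} → Fin n → Set
IsUnit {n} a = ∃[ b ] rep a * rep {n} b ≋ 1ℤ [mod n ]

-- The edge relation of Gₙ, on ordered pairs of vertices. It is symmetric when
-- -1 is the square of a unit, in particular when every prime factor of n is
-- congruent to 1 modulo 4.
PaleyAdj : ∀ n → Rel (Fin n) 0ℓ
PaleyAdj n x y =
  ∃[ a ] IsUnit {n} a × rep x - rep y ≋ rep a * rep a [mod n ]

-- Adjacency is demanded of both (x , y) and (y , x), so nothing is lost by not
-- bundling a proof that E is symmetric. Loops play no role.
IsClique : ∀ {n} → Rel (Fin n) 0ℓ → Subset n → Set
IsClique E S = ∀ {x y} → x ∈ S → y ∈ S → x ≢ y → E x y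

IsCliqueNumber : ∀ {n} → Rel (Fin n) 0ℓ → ℕ → Set
IsCliqueNumber E ω =
  (∃[ S ] IsClique E S × ∣ S ∣ ≡ ω) × (∀ S → IsClique E S → ∣ S ∣ ≤ ω)

{-# OPTIONS --safe #-}

-- An edge of Gₙ has as difference the square of a unit modulo every divisor of
-- n, so a clique of Gₙ maps injectively to a clique of G₅, G₁₃ or G₁₇, where
-- finitely many cases bound its size. Conversely {0 , 1} is a clique once -1 is
-- a square modulo n, and {0 , 9 , 25} is one when 3, 4 and 5 are also units,
-- because 9 + 16 = 25. That -1 is a square modulo n follows from the case of a
-- prime by Hensel lifting and the Chinese remainder theorem; modulo a prime
-- p = 4j + 5, the involution x ↦ ±1/x of {2 , … , 2j + 2}, a set of odd size,
-- has a fixed point, which satisfies x² = ±1 but not x² = 1.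
module Submission where

open import Defs
open import Data.Empty using (⊥)
open import Data.Fin using (Fin; zero; suc; toℕ; fromℕ<)
open import Data.Fin.Properties using (all?; any?; toℕ-fromℕ<; suc-injective)
open import Data.Fin.Subset as Subset using (Subset; _∈_; _∉_; inside; outside)
open import Data.Fin.Subset.Properties using (∉⊥; ∣⊥∣≡0)
open import Data.Integer using (ℤ; +_; -_; _+_; _-_; _*_; 0ℤ; 1ℤ)
open import Data.Integer.DivMod using (_%ℕ_; _/ℕ_; n%ℕd<d; a≡a%ℕn+[a/ℕn]*n)
open import Data.Integer.Divisibility.Signed
  using (_∣_; divides; ∣ᵤ⇒∣; ∣⇒∣ᵤ; ∣-trans; ∣m∣n⇒∣m+n; ∣m⇒∣-m; ∣m∣n⇒∣m-n;
         ∣n⇒∣m*n; ∣m⇒∣m*n; _∣?_)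
import Data.Integer.Properties as ℤ
open import Data.Integer.Tactic.RingSolver using (solve-∀)
open import Data.List using (List; []; _∷_; _++_; length; map; applyUpTo)
open import Data.List.Membership.Propositional using () renaming (_∈_ to _∈ˡ_)
open import Data.List.Membership.Propositional.Properties
  using (∈-∃++; ∈-applyUpTo⁺; ∈-applyUpTo⁻; ∈-tabulate⁺)
open import Data.List.Properties using (length-applyUpTo; length-map)
open import Data.List.Relation.Binary.Permutation.Propositional
  using (_↭_; ↭-sym; ↭⇒↭ₛ)
open import Data.List.Relation.Binary.Permutation.Propositional.Properties
  using (shift; ∈-resp-↭; ↭-length)
open import Data.List.Relation.Binary.Permutation.Setoid.Properties
  using (Unique-resp-↭)
open import Data.List.Relation.Unary.All as All using (All; []; _∷_)
open import Data.List.Relation.Unary.AllPairs as AllPairs using (AllPairs; []; _∷_)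
import Data.List.Relation.Unary.All.Properties as All
import Data.List.Relation.Unary.AllPairs.Properties as AllPairs
open import Data.List.Relation.Unary.Any using (here; there)
open import Data.List.Relation.Unary.Unique.Propositional using (Unique)
open import Data.List.Relation.Unary.Unique.Propositional.Properties using (applyUpTo⁺₁)
open import Data.Nat as ℕ using (ℕ; zero; suc; _≥_; _%_; _≤_; _<_; _^_; NonZero; z≤n; s≤s)
open import Data.Nat.Coprimality as Coprime using (Coprime; coprime-Bézout)
open import Data.Nat.Divisibility as ℕ∣ using (_∤_)
open import Data.Nat.DivMod using (m≡m%n+[m/n]*n)
open import Data.Nat.GCD using (module Bézout)
open import Data.Nat.ListAction.Properties using (∈⇒∣product)
open import Data.Nat.Primality
  using (Prime; prime?; euclidsLemma; prime⇒irreducible; prime⇒nonZero; prime⇒nonTrivial)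
import Data.Nat.Properties as ℕ
import Data.Nat.Tactic.RingSolver as ℕRing
open import Data.Product using (_×_; ∃-syntax; _,_; proj₁; proj₂)
open import Data.Sum as Sum using (_⊎_; inj₁; inj₂; [_,_]′)
open import Data.Vec using ([]; _∷_; here; there; _[_]≔_)
open import Function using (_∘_; case_of_; id)
open import Function.Definitions using (Injective)
open import Level using (0ℓ)
open import Relation.Binary using (Rel; Symmetric)
open import Relation.Binary.PropositionalEquality
  using (_≡_; _≢_; refl; sym; trans; cong; cong₂; subst; setoid)
open import Relation.Nullary using (¬_; Dec; yes; no; contradiction; ¬?)
open import Relation.Nullary.Decidable using (_×-dec_; _→-dec_; map′; from-yes)

-- Divisibility

∣-resp-≡ : ∀ {k i j : ℤ} → i ≡ j → k ∣ i → k ∣ j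
∣-resp-≡ {k} = subst (k ∣_)

euclid : ∀ {p} i j → Prime p → + p ∣ i * j → + p ∣ i ⊎ + p ∣ j
euclid {p} i j pp d =
  Sum.map ∣ᵤ⇒∣ ∣ᵤ⇒∣
    (euclidsLemma _ _ pp (subst (p ℕ∣.∣_) (ℤ.abs-* i j) (∣⇒∣ᵤ d)))

prime∤1 : ∀ {p} → Prime p → p ∤ 1
prime∤1 {p} pp p∣1 = ℕ.nonTrivial⇒≢1 {{prime⇒nonTrivial pp}} (ℕ∣.∣1⇒≡1 p∣1)

∤⇒coprime : ∀ {p n} → Prime p → p ∤ n → Coprime p n
∤⇒coprime pp p∤n (d∣p , d∣n) with prime⇒irreducible pp d∣p
... | inj₁ d≡1 = d≡1
... | inj₂ refl = contradiction d∣n p∤n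

-- Unlike `IsUnit`, this speaks of integers: the same witness then serves modulo every divisor of
-- `n`, and ring identities over `ℤ` apply directly.
record Unit (n : ℕ) (a : ℤ) : Set where
  constructor unit
  field
    inverse   : ℤ
    isInverse : a * inverse ≋ 1ℤ [mod n ]

coprime⇒unit : ∀ {a n} → Coprime a n → Unit n (+ a)
coprime⇒unit {a} {n} c with coprime-Bézout c
... | Bézout.+- x y eq = unit (+ x) (divides (+ y) (trans
  (cong (_- 1ℤ) (trans (ℤ.*-comm (+ a) (+ x)) (trans (sym (ℤ.pos-* x a)) (cong +_ (sym eq)))))
  (trans (cong (λ z → 1ℤ + z - 1ℤ) (ℤ.pos-* y n)) (lemma (+ y * + n)))))
  where
  lemma : ∀ z → 1ℤ + z - 1ℤ ≡ z
  lemma = solve-∀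
-- Here the Bézout identity is `1 + x a = y n`, so the inverse of `a` is `- x`.
... | Bézout.-+ x y eq = unit (- + x) (divides (- + y) (trans
  (lemma (+ a) (+ x))
  (trans (cong -_ (trans (cong (λ z → 1ℤ + z) (sym (ℤ.pos-* x a))) (trans (cong +_ eq) (ℤ.pos-* y n))))
    (ℤ.neg-distribˡ-* (+ y) (+ n)))))
  where
  lemma : ∀ a x → a * (- x) - 1ℤ ≡ - (1ℤ + x * a)
  lemma = solve-∀

residue : ∀ n .{{_ : NonZero n}} → ℤ → Fin n
residue n a = fromℕ< (n%ℕd<d a n)

≋-residue : ∀ n .{{_ : NonZero n}} a → a ≋ rep (residue n a) [mod n ]
≋-residue n a = divides (a /ℕ n) (trans
  (cong₂ _-_ (a≡a%ℕn+[a/ℕn]*n a n) (cong +_ (toℕ-fromℕ< (n%ℕd<d a n))))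
  (lemma (+ (a %ℕ n)) (a /ℕ n * + n)))
  where
  lemma : ∀ r q → r + q - r ≡ q
  lemma = solve-∀

pos-∣ : ∀ {n a} → + n ∣ + a → n ℕ∣.∣ a
pos-∣ = ∣⇒∣ᵤ

-- The natural number `a ∸ b` is a multiple of `n` below `n`, hence zero.
∣-difference⇒≥ : ∀ {n a b} → b ≤ a → a < n → + n ∣ + a - + b → a ≤ b
∣-difference⇒≥ {n} {a} {b} b≤a a<n d = ℕ.m∸n≡0⇒m≤n (zero? (a ℕ.∸ b) refl)
  where
  d′ : n ℕ∣.∣ a ℕ.∸ b
  d′ = pos-∣ (∣-resp-≡ (trans (ℤ.m-n≡m⊖n a b) (ℤ.⊖-≥ b≤a)) d)
  zero? : ∀ c → a ℕ.∸ b ≡ c → c ≡ 0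
  zero? zero _ = refl
  zero? (suc c) eq = contradiction
    (ℕ.≤-trans (ℕ∣.∣⇒≤ (subst (n ℕ∣.∣_) eq d′)) (subst (_≤ a) eq (ℕ.m∸n≤m a b)))
    (ℕ.<⇒≱ a<n)

∣-difference⇒≡ : ∀ {n a b} → a < n → b < n → + n ∣ + a - + b → a ≡ b
∣-difference⇒≡ {n} {a} {b} a<n b<n d with ℕ.≤-total b a
... | inj₁ b≤a = ℕ.≤-antisym (∣-difference⇒≥ b≤a a<n d) b≤a
... | inj₂ a≤b = ℕ.≤-antisym a≤b
  (∣-difference⇒≥ a≤b b<n (∣-resp-≡ (lemma (+ a) (+ b)) (∣m⇒∣-m d)))
  where
  lemma : ∀ a b → - (a - b) ≡ b - a
  lemma = solve-∀

a²-b² : ∀ a b → a * a - b * b ≡ (a - b) * (a + b)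
a²-b² = solve-∀

-- The prime divides `(y - z)(y + z)`, but not `y + z`, which lies strictly between 0 and `p`. So
-- squaring is injective modulo an odd `p` on 1, ..., (p - 1)/2.
square-injective : ∀ {p y z} → Prime p → 0 < y → y ℕ.+ z < p →
  + p ∣ + y * + y - + z * + z → y ≡ z
square-injective {p} {y} {z} pp 0<y y+z<p d =
  [ ∣-difference⇒≡ (ℕ.≤-<-trans (ℕ.m≤m+n y z) y+z<p) (ℕ.≤-<-trans (ℕ.m≤n+m z y) y+z<p)
  , (λ d′ → contradiction (ℕ∣.∣⇒≤ {{ℕ.>-nonZero (ℕ.≤-trans 0<y (ℕ.m≤m+n y z))}} (pos-∣ d′))
                          (ℕ.<⇒≱ y+z<p))
  ]′ (euclid (+ y - + z) (+ y + + z) pp (∣-resp-≡ (a²-b² (+ y) (+ z)) d))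

-- Of the representatives ±a modulo p, one is at most half of p.
halfRepresentative : ∀ {p h} .{{_ : NonZero p}} → p ≤ suc h ℕ.+ h →
  ∀ a → ∃[ y ] y ≤ h × + p ∣ + y * + y - a * a
halfRepresentative {p} {h} p≤1+h+h a = split (a %ℕ p) (a /ℕ p) (n%ℕd<d a p) (a≡a%ℕn+[a/ℕn]*n a p)
  where
  split : ∀ r q → r < p → a ≡ + r + q * + p → ∃[ y ] y ≤ h × + p ∣ + y * + y - a * a
  split r q r<p a≡ with r ℕ.≤? h
  ... | yes r≤h = r , r≤h , ∣-resp-≡ (sym (a²-b² (+ r) a))
    (∣m⇒∣m*n (+ r + a) (divides (- q) (trans (cong (λ z → + r - z) a≡) (lemma (+ r) q (+ p)))))
    where
    lemma : ∀ r q p → r - (r + q * p) ≡ - q * p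
    lemma = solve-∀
  -- Now `p ∸ r` represents `- a`, and `p ≤ 1 + h + h ≤ r + h` bounds it by `h`.
  ... | no r≰h = p ℕ.∸ r , y≤h , ∣-resp-≡ (sym (a²-b² (+ (p ℕ.∸ r)) a))
    (∣n⇒∣m*n (+ (p ℕ.∸ r) - a)
      (divides (1ℤ + q) (trans (cong₂ _+_ y≡ a≡) (lemma (+ p) (+ r) q))))
    where
    y≤h : p ℕ.∸ r ≤ h
    y≤h = ℕ.m≤n+o⇒m∸n≤o p r (ℕ.≤-trans p≤1+h+h (ℕ.+-monoˡ-≤ h (ℕ.≰⇒> r≰h)))
    y≡ : + (p ℕ.∸ r) ≡ + p - + r
    y≡ = sym (trans (ℤ.m-n≡m⊖n p r) (ℤ.⊖-≥ (ℕ.<⇒≤ r<p)))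
    lemma : ∀ p r q → (p - r) + (r + q * p) ≡ (1ℤ + q) * p
    lemma = solve-∀

-- Square roots of -1

-- R is the graph of an involution on xs; if y ≠ x is the partner of x, then the
-- rest of xs is again closed under R.
odd-involution-fixedPoint : ∀ {A : Set} {R : Rel A 0ℓ} → Symmetric R →
  ∀ j (xs : List A) → length xs ≡ suc (2 ℕ.* j) → Unique xs →
  (∀ {x} → x ∈ˡ xs → ∃[ y ] y ∈ˡ xs × R x y) →
  (∀ {x y z} → x ∈ˡ xs → y ∈ˡ xs → z ∈ˡ xs → R x y → R x z → y ≡ z) →
  ∃[ x ] x ∈ˡ xs × R x x
odd-involution-fixedPoint _ j (x ∷ ys) len (x≢ ∷ u) partner functional with partner (here refl)
... | _ , here refl , Rxx = x , here refl , Rxx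
... | y , there y∈ys , Rxy with ∈-∃++ y∈ys
-- A list of length 1 has no room for both `x` and `y`.
odd-involution-fixedPoint _ zero (x ∷ ys) len _ _ _ | y , there y∈ys , _ | as , bs , refl
  with () ← trans (sym (ℕ.suc-injective len)) (↭-length (shift y as bs))
odd-involution-fixedPoint {A} {R} R-sym (suc j) (x ∷ ys) len (x≢ ∷ u) partner functional
  | y , there y∈ys , Rxy | as , bs , refl =
  case odd-involution-fixedPoint {R = R} R-sym j zs len′ (AllPairs.tail uy) partner′
          (λ a b c → functional (⊆xs a) (⊆xs b) (⊆xs c)) of λ
    { (w , w∈ , Rww) → w , ⊆xs w∈ , Rww }
  where
  zs = as ++ bs
  ys↭ : ys ↭ y ∷ zs
  ys↭ = shift y as bs
  uy : Unique (y ∷ zs)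
  uy = Unique-resp-↭ (setoid A) (↭⇒↭ₛ ys↭) u
  ⊆ys : ∀ {w} → w ∈ˡ zs → w ∈ˡ ys
  ⊆ys w∈ = ∈-resp-↭ (↭-sym ys↭) (there w∈)
  ⊆xs : ∀ {w} → w ∈ˡ zs → w ∈ˡ x ∷ ys
  ⊆xs = there ∘ ⊆ys
  len′ : length zs ≡ suc (2 ℕ.* j)
  len′ = ℕ.suc-injective (trans (sym (↭-length ys↭))
           (trans (ℕ.suc-injective len) (cong suc (ℕ.+-suc j (j ℕ.+ 0)))))
  -- If the partner of `z` were `x` or `y`, symmetry and functionality would identify `z` with `y`
  -- or `x` respectively, against uniqueness.
  partner′ : ∀ {z} → z ∈ˡ zs → ∃[ w ] w ∈ˡ zs × R z w
  partner′ z∈ with partner (⊆xs z∈)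
  ... | _ , here refl , Rzx = contradiction
    (functional (here refl) (there y∈ys) (⊆xs z∈) Rxy (R-sym Rzx))
    (All.lookup (AllPairs.head uy) z∈)
  ... | w , there w∈ys , Rzw with ∈-resp-↭ ys↭ w∈ys
  ... | here refl = contradiction
    (functional (there y∈ys) (here refl) (⊆xs z∈) (R-sym Rxy) (R-sym Rzw))
    (All.lookup x≢ (⊆ys z∈))
  ... | there w∈zs = w , w∈zs , Rzw

MinusOneSquare : ℕ → Set
MinusOneSquare n = ∃[ x ] + n ∣ x * x + 1ℤ

module _ {p} (pp : Prime p) (j : ℕ) (p≡4j+5 : p ≡ 5 ℕ.+ 4 ℕ.* j) where

  private
    -- This is (p - 1)/2, so 1, ..., `h` contains exactly one of each pair of nonzero classes ±a.
    h = 2 ℕ.+ 2 ℕ.* j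

    p≡1+h+h : p ≡ suc h ℕ.+ h
    p≡1+h+h = trans p≡4j+5 (lemma j)
      where
      lemma : ∀ j → 5 ℕ.+ 4 ℕ.* j ≡ suc ((2 ℕ.+ 2 ℕ.* j) ℕ.+ (2 ℕ.+ 2 ℕ.* j))
      lemma = ℕRing.solve-∀

    sum<p : ∀ {y z} → y ≤ h → z ≤ h → y ℕ.+ z < p
    sum<p y≤h z≤h = ℕ.≤-trans (s≤s (ℕ.+-mono-≤ y≤h z≤h)) (ℕ.≤-reflexive (sym p≡1+h+h))

    -- These are 2, ..., `h`. The number 1 is left out because it is related to itself without being
    -- a root of -1; since `h` is even, an odd number of elements remains.
    xs : List ℕ
    xs = applyUpTo (2 ℕ.+_) (suc (2 ℕ.* j))

    bounds : ∀ {x} → x ∈ˡ xs → 2 ≤ x × x ≤ h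
    bounds x∈ with ∈-applyUpTo⁻ (2 ℕ.+_) x∈
    ... | i , s≤s i≤ , refl = s≤s (s≤s z≤n) , s≤s (s≤s i≤)

    ∈-xs : ∀ {x} → 2 ≤ x → x ≤ h → x ∈ˡ xs
    ∈-xs (s≤s (s≤s z≤n)) (s≤s (s≤s i≤)) = ∈-applyUpTo⁺ (2 ℕ.+_) (s≤s i≤)

    -- For a prime p this says y = ±1/x modulo p.
    R : Rel ℕ 0ℓ
    R x y = + p ∣ (+ x * + y) * (+ x * + y) - 1ℤ

    -- Squaring is injective on 1, ..., `h`, and 1 is already a root of 1 there.
    square≢1 : ∀ {x} → 2 ≤ x → x ≤ h → ¬ (+ p ∣ + x * + x - 1ℤ)
    square≢1 2≤x x≤h d = ℕ.<⇒≢ 2≤x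
      (sym (square-injective pp (ℕ.≤-trans (s≤s z≤n) 2≤x) (sum<p x≤h (s≤s z≤n)) d))

    R-sym : Symmetric R
    R-sym {x} {y} = ∣-resp-≡ (cong (λ z → z * z - 1ℤ) (ℤ.*-comm (+ x) (+ y)))

    -- The combination `z²((xy)² - 1) - y²((xz)² - 1)` cancels `x` and leaves `y² - z²`.
    functional : ∀ {x y z} → x ∈ˡ xs → y ∈ˡ xs → z ∈ˡ xs → R x y → R x z → y ≡ z
    functional {x} {y} {z} _ y∈ z∈ Rxy Rxz =
      square-injective pp (ℕ.≤-trans (s≤s z≤n) (proj₁ (bounds y∈)))
        (sum<p (proj₂ (bounds y∈)) (proj₂ (bounds z∈)))
        (∣-resp-≡ (lemma (+ x) (+ y) (+ z))
          (∣m∣n⇒∣m-n (∣n⇒∣m*n (+ z * + z) Rxy) (∣n⇒∣m*n (+ y * + y) Rxz)))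
      where
      lemma : ∀ x y z → z * z * ((x * y) * (x * y) - 1ℤ) - y * y * ((x * z) * (x * z) - 1ℤ)
        ≡ y * y - z * z
      lemma = solve-∀

    -- An inverse `a` of `x` is replaced by whichever of its representatives up to sign is at most
    -- `h`; the squares in `R` absorb the sign.
    inverse : ∀ {x} → 2 ≤ x → x ≤ h → ∃[ y ] y ≤ h × R x y
    inverse {x} 2≤x x≤h =
      let unit a d = coprime⇒unit (Coprime.sym (∤⇒coprime {n = x} pp
            (ℕ.<⇒≱ (ℕ.≤-<-trans (ℕ.m≤m+n x 0) (sum<p x≤h z≤n))
              ∘ ℕ∣.∣⇒≤ {{ℕ.>-nonZero (ℕ.≤-trans (s≤s z≤n) 2≤x)}})))
          y , y≤h , e = halfRepresentative {{prime⇒nonZero pp}} (ℕ.≤-reflexive p≡1+h+h) a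
      in y , y≤h , ∣-resp-≡ (lemma (+ x) (+ y) a)
           (∣m∣n⇒∣m+n (∣n⇒∣m*n (+ x * + x) e) (∣m⇒∣m*n (+ x * a + 1ℤ) d))
      where
      lemma : ∀ x y a → x * x * (y * y - a * a) + (x * a - 1ℤ) * (x * a + 1ℤ)
        ≡ (x * y) * (x * y) - 1ℤ
      lemma = solve-∀

    partner : ∀ {x} → x ∈ˡ xs → ∃[ y ] y ∈ˡ xs × R x y
    partner {x} x∈ = 2≤ (inverse 2≤x x≤h)
      where
      2≤x = proj₁ (bounds x∈)
      x≤h = proj₂ (bounds x∈)
      x0 : ∀ x → - (x * 0ℤ * (x * 0ℤ) - 1ℤ) ≡ 1ℤ
      x0 = solve-∀
      x1 : ∀ x → x * 1ℤ * (x * 1ℤ) - 1ℤ ≡ x * x - 1ℤ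
      x1 = solve-∀
      2≤ : ∃[ y ] y ≤ h × R x y → ∃[ y ] y ∈ˡ xs × R x y
      -- `R x 0` would make `p` divide -1, and `R x 1` would make `x` a root of 1.
      2≤ (0 , _ , Rx0) =
        contradiction (pos-∣ (∣-resp-≡ (x0 (+ x)) (∣m⇒∣-m Rx0))) (prime∤1 pp)
      2≤ (1 , _ , Rx1) = contradiction (∣-resp-≡ (x1 (+ x)) Rx1) (square≢1 2≤x x≤h)
      2≤ (y@(suc (suc _)) , y≤h , Rxy) = y , ∈-xs (s≤s (s≤s z≤n)) y≤h , Rxy

  minusOneSquare-4j+5 : MinusOneSquare p
  minusOneSquare-4j+5 =
    let x , x∈ , Rxx = odd-involution-fixedPoint {R = R} (λ {x} {y} → R-sym {x} {y}) j xs
          (length-applyUpTo (2 ℕ.+_) (suc (2 ℕ.* j)))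
          (applyUpTo⁺₁ (2 ℕ.+_) (suc (2 ℕ.* j))
            (λ i<k _ eq → ℕ.<⇒≢ i<k (ℕ.+-cancelˡ-≡ 2 _ _ eq)))
          partner (λ {x} → functional {x})
        2≤x , x≤h = bounds x∈
    -- `R x x` says `x⁴ ≡ 1`, and `x⁴ - 1 = (x² - 1)(x² + 1)`.
    in + x , [ (λ d → contradiction d (square≢1 2≤x x≤h)) , id ]′
         (euclid (+ x * + x - 1ℤ) (+ x * + x + 1ℤ) pp
           (∣-resp-≡ (a²-b² (+ x * + x) 1ℤ) Rxx))

-- Square roots of -1 modulo composite numbers

*-mono-∣ : ∀ {m n i j} → + m ∣ i → + n ∣ j → + (m ℕ.* n) ∣ i * j
*-mono-∣ {m} {n} (divides q refl) (divides r refl) = divides (q * r) (trans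
  (lemma q (+ m) r (+ n)) (cong (q * r *_) (sym (ℤ.pos-* m n))))
  where
  lemma : ∀ q m r n → q * m * (r * n) ≡ q * r * (m * n)
  lemma = solve-∀

-- Newton's iteration for y² + 1, where 1/(2x) = -x/2 modulo m.
minusOneSquare-hensel : ∀ {p m} → p ℕ∣.∣ m → Unit p (+ 2) →
  MinusOneSquare m → MinusOneSquare (p ℕ.* m)
minusOneSquare-hensel {p} {m} p∣m (unit h 2h≋1) (x , d) =
  x + h * x * (x * x + 1ℤ) ,
  ∣-resp-≡ (lemma x h) (*-mono-∣
    (∣m∣n⇒∣m+n (∣m⇒∣m*n (1ℤ + h * h * (x * x)) (∣-trans (∣ᵤ⇒∣ p∣m) d)) (∣m⇒∣m*n (x * x) 2h≋1)) d)
  where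
  lemma : ∀ x h →
    ((x * x + 1ℤ) * (1ℤ + h * h * (x * x)) + (+ 2 * h - 1ℤ) * (x * x)) * (x * x + 1ℤ)
    ≡ (x + h * x * (x * x + 1ℤ)) * (x + h * x * (x * x + 1ℤ)) + 1ℤ
  lemma = solve-∀

prime-*-∣ : ∀ {p m i} → Prime p → p ∤ m → + p ∣ i → + m ∣ i → + (p ℕ.* m) ∣ i
prime-*-∣ {p} {m} pp p∤m p∣i (divides q refl) =
  [ (λ p∣q → *-mono-∣ p∣q (divides 1ℤ (sym (ℤ.*-identityˡ (+ m)))))
  , (λ p∣m → contradiction (pos-∣ p∣m) p∤m)
  ]′ (euclid q (+ m) pp p∣i)

minusOneSquare-crt : ∀ {p m} → Prime p → p ∤ m →
  MinusOneSquare p → MinusOneSquare m → MinusOneSquare (p ℕ.* m)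
minusOneSquare-crt {p} {m} pp p∤m (s , p∣) (x , m∣) =
  let unit b mb≋1 = coprime⇒unit (Coprime.sym (∤⇒coprime pp p∤m))
      -- As `b` inverts `m` modulo `p`, `x + m t` is congruent to `s` modulo `p` and still to `x`
      -- modulo `m`.
      t = b * (s - x)
  in x + + m * t , prime-*-∣ pp p∤m
       (∣-resp-≡ (modp s x (+ m) b)
         (∣m∣n⇒∣m+n (∣m⇒∣m*n ((s - x) * (x + + m * t + s)) mb≋1) p∣))
       (∣-resp-≡ (modm x (+ m) t)
         (∣m∣n⇒∣m+n m∣ (divides (t * (+ 2 * x + + m * t)) (ℤ.*-comm (+ m) _))))
  where
  modp : ∀ s x m b →
    (m * b - 1ℤ) * ((s - x) * (x + m * (b * (s - x)) + s)) + (s * s + 1ℤ)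
    ≡ (x + m * (b * (s - x))) * (x + m * (b * (s - x))) + 1ℤ
  modp = solve-∀
  modm : ∀ x m t → x * x + 1ℤ + m * (t * (+ 2 * x + m * t)) ≡ (x + m * t) * (x + m * t) + 1ℤ
  modm = solve-∀

prime∤prime : ∀ {p q} → Prime p → Prime q → q ≢ p → q ∤ p
prime∤prime pp pq q≢p q∣p with prime⇒irreducible pp q∣p
... | inj₁ refl = prime∤1 pq ℕ∣.∣-refl
... | inj₂ q≡p = q≢p q≡p

minusOneSquare-prime : ∀ {p} → Prime p → p % 4 ≡ 1 → MinusOneSquare p
minusOneSquare-prime {p} pp p%4≡1 = go (p ℕ./ 4) (trans (m≡m%n+[m/n]*n p 4) (cong (ℕ._+ p ℕ./ 4 ℕ.* 4) p%4≡1))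
  where
  go : ∀ k → p ≡ 1 ℕ.+ k ℕ.* 4 → MinusOneSquare p
  -- The quotient of `p` by 4 is positive because `p` is not 1; its predecessor is `j`.
  go zero p≡1 = contradiction (ℕ∣.∣-reflexive p≡1) (prime∤1 pp)
  go (suc j) p≡ = minusOneSquare-4j+5 pp j (trans p≡ (cong (5 ℕ.+_) (ℕ.*-comm j 4)))

-- A repeated prime is handled by Hensel lifting, a new one by the Chinese remainder theorem.
minusOneSquare-prime-* : ∀ {p m} → Prime p → p % 4 ≡ 1 →
  MinusOneSquare m → MinusOneSquare (p ℕ.* m)
minusOneSquare-prime-* {p} {m} pp p%4≡1 sq with p ℕ∣.∣? m
... | yes p∣m = minusOneSquare-hensel p∣m
  (coprime⇒unit (∤⇒coprime (from-yes (prime? 2)) (prime∤prime pp (from-yes (prime? 2))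
    λ { refl → case p%4≡1 of λ () }))) sq
... | no p∤m = minusOneSquare-crt pp p∤m (minusOneSquare-prime pp p%4≡1) sq

-- The product is built from 1 by one prime factor at a time. This serves both for roots of -1
-- modulo `n` and for showing that a given prime does not divide `n`.
primePowerProduct-induction : (P : ℕ → Set) → P 1 →
  ∀ {k} (p α : Fin k → ℕ) → (∀ i {m} → P m → P (p i ℕ.* m)) → P (primePowerProduct p α)
primePowerProduct-induction P P1 {zero} p α step = P1
primePowerProduct-induction P P1 {suc k} p α step =
  power (α zero) (primePowerProduct-induction P P1 (p ∘ suc) (α ∘ suc) (step ∘ suc))
  where
  power : ∀ a {m} → P m → P (p zero ^ a ℕ.* m)
  power zero {m} Pm = subst P (sym (ℕ.*-identityˡ m)) Pm
  power (suc a) {m} Pm =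
    subst P (sym (ℕ.*-assoc (p zero) (p zero ^ a) m)) (step zero (power a Pm))

factor-∣-primePowerProduct : ∀ {k} (p α : Fin k → ℕ) i → α i ≥ 1 →
  p i ℕ∣.∣ primePowerProduct p α
factor-∣-primePowerProduct p α i α≥1 = ℕ∣.∣-trans (∣-power (α i) α≥1)
  (∈⇒∣product (∈-tabulate⁺ {f = λ i → p i ^ α i} i))
  where
  ∣-power : ∀ a → a ≥ 1 → p i ℕ∣.∣ p i ^ a
  ∣-power (suc a) _ = ℕ∣.m∣m*n (p i ^ a)

-- Unit squares

record UnitSquare (n : ℕ) (z : ℤ) : Set where
  constructor unitSquare
  field
    root   : ℤ
    isUnit : Unit n root
    isRoot : z ≋ root * root [mod n ]

square-resp : ∀ {n} z a r → z ≋ a * a [mod n ] → a ≋ r [mod n ] → z ≋ r * r [mod n ]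
square-resp z a r z≋a² a≋r =
  ∣-resp-≡ (lemma z a r) (∣m∣n⇒∣m+n z≋a² (∣m⇒∣m*n (a + r) a≋r))
  where
  lemma : ∀ z a r → z - a * a + (a - r) * (a + r) ≡ z - r * r
  lemma = solve-∀

unitSquare-∣ : ∀ {m n z} → m ℕ∣.∣ n → UnitSquare n z → UnitSquare m z
unitSquare-∣ m∣n (unitSquare a (unit b ab≋1) z≋a²) =
  unitSquare a (unit b (∣-trans (∣ᵤ⇒∣ m∣n) ab≋1)) (∣-trans (∣ᵤ⇒∣ m∣n) z≋a²)

unitSquare-resp : ∀ {n z w} → z ≋ w [mod n ] → UnitSquare n z → UnitSquare n w
unitSquare-resp {z = z} {w} z≋w (unitSquare a u z≋a²) =
  unitSquare a u (∣-resp-≡ (lemma z w a) (∣m∣n⇒∣m-n z≋a² z≋w))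
  where
  lemma : ∀ z w a → z - a * a - (z - w) ≡ w - a * a
  lemma = solve-∀

unit-* : ∀ {n a c} → Unit n a → Unit n c → Unit n (a * c)
unit-* {a = a} {c} (unit b ab≋1) (unit d cd≋1) = unit (b * d)
  (∣-resp-≡ (lemma a b c d) (∣m∣n⇒∣m+n (∣m⇒∣m*n (c * d) ab≋1) cd≋1))
  where
  lemma : ∀ a b c d → (a * b - 1ℤ) * (c * d) + (c * d - 1ℤ) ≡ a * c * (b * d) - 1ℤ
  lemma = solve-∀

unit⇒unitSquare : ∀ {n a} → Unit n a → UnitSquare n (a * a)
unit⇒unitSquare {a = a} u = unitSquare a u (divides 0ℤ (ℤ.i≡j⇒i-j≡0 {a * a} refl))

-- A root `x` of -1 is itself a unit, with inverse `- x`, so `x * a` is a root for `- z`. This gives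
-- the symmetry of Gₙ.
unitSquare-neg : ∀ {n z} → MinusOneSquare n → UnitSquare n z → UnitSquare n (- z)
unitSquare-neg {n} {z} (x , x²≋-1) (unitSquare a u z≋a²) =
  unitSquare (x * a) (unit-* x-unit u)
    (∣-resp-≡ (lemma′ x a z) (∣m⇒∣-m (∣m∣n⇒∣m+n z≋a² (∣m⇒∣m*n (a * a) x²≋-1))))
  where
  lemma : ∀ x → - (x * x + 1ℤ) ≡ x * (- x) - 1ℤ
  lemma = solve-∀
  lemma′ : ∀ x a z → - (z - a * a + (x * x + 1ℤ) * (a * a)) ≡ - z - x * a * (x * a)
  lemma′ = solve-∀
  x-unit : Unit n x
  x-unit = unit (- x) (∣-resp-≡ (lemma x) (∣m⇒∣-m x²≋-1))

-- Otherwise `a² ≡ 0`, and multiplying by `b²` gives `1 ≡ 0`. Hence Gₙ has no loops for `n ≢ 1`.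
unitSquare⇒∤ : ∀ {n z} → n ≢ 1 → UnitSquare n z → ¬ (+ n ∣ z)
unitSquare⇒∤ {z = z} n≢1 (unitSquare a (unit b ab≋1) z≋a²) n∣z = n≢1 (ℕ∣.∣1⇒≡1 (pos-∣
  (∣-resp-≡ (lemma a b z)
    (∣m∣n⇒∣m-n (∣n⇒∣m*n (b * b) (∣m∣n⇒∣m-n n∣z z≋a²)) (∣m⇒∣m*n (a * b + 1ℤ) ab≋1)))))
  where
  lemma : ∀ a b z → b * b * (z - (z - a * a)) - (a * b - 1ℤ) * (a * b + 1ℤ) ≡ 1ℤ
  lemma = solve-∀

paleyAdj⇒unitSquare : ∀ {n} (x y : Fin n) → PaleyAdj n x y → UnitSquare n (rep x - rep y)
paleyAdj⇒unitSquare _ _ (a , (b , ab≋1) , d) = unitSquare (rep a) (unit (rep b) ab≋1) d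

unitSquare⇒paleyAdj : ∀ {n} .{{_ : NonZero n}} (x y : Fin n) →
  UnitSquare n (rep x - rep y) → PaleyAdj n x y
unitSquare⇒paleyAdj {n} x y (unitSquare a (unit b ab≋1) d) =
  r ,
  (s , ∣-resp-≡ (lemma a b (rep r) (rep s))
    (∣m∣n⇒∣m-n ab≋1 (∣m∣n⇒∣m+n (∣m⇒∣m*n b a≋r) (∣n⇒∣m*n (rep r) (≋-residue n b))))) ,
  square-resp (rep x - rep y) a (rep r) d a≋r
  where
  r = residue n a
  s = residue n b
  a≋r = ≋-residue n a
  lemma : ∀ a b r s → a * b - 1ℤ - ((a - r) * b + r * (b - s)) ≡ r * s - 1ℤ
  lemma = solve-∀

paleyAdj-residue : ∀ {n} .{{_ : NonZero n}} z w →
  UnitSquare n (z - w) → PaleyAdj n (residue n z) (residue n w)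
paleyAdj-residue {n} z w u = unitSquare⇒paleyAdj (residue n z) (residue n w)
  (unitSquare-resp (∣-resp-≡ (lemma z w (rep (residue n z)) (rep (residue n w)))
    (∣m∣n⇒∣m-n (≋-residue n z) (≋-residue n w))) u)
  where
  lemma : ∀ z w r s → z - r - (w - s) ≡ z - w - (r - s)
  lemma = solve-∀

paleyAdj⇒≢ : ∀ {n} {x y : Fin n} → n ≢ 1 → PaleyAdj n x y → x ≢ y
paleyAdj⇒≢ {x = x} n≢1 e refl = unitSquare⇒∤ n≢1 (paleyAdj⇒unitSquare x x e)
  (divides 0ℤ (ℤ.i≡j⇒i-j≡0 {rep x} refl))

-- Finite checks modulo 5, 13 and 17

record NonzeroSquare (p : ℕ) (z : ℤ) : Set where
  constructor nonzeroSquare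
  field
    -- A root in `Fin p` can be found by exhaustive search, and for prime `p` being nonzero is the
    -- same as being a unit.
    root    : Fin p
    nonzero : toℕ root ≢ 0
    isRoot  : z ≋ rep root * rep root [mod p ]

nonzeroSquare? : ∀ p z → Dec (NonzeroSquare p z)
nonzeroSquare? p z = map′
  (λ { (a , a≢0 , z≋a²) → nonzeroSquare a a≢0 z≋a² })
  (λ { (nonzeroSquare a a≢0 z≋a²) → a , a≢0 , z≋a² })
  (any? λ a → ¬? (toℕ a ℕ.≟ 0) ×-dec (+ p ∣? z - rep a * rep a))

unitSquare⇒nonzeroSquare : ∀ {p z} .{{_ : NonZero p}} → p ≢ 1 →
  UnitSquare p z → NonzeroSquare p z
unitSquare⇒nonzeroSquare {p} {z} p≢1 u@(unitSquare a _ z≋a²) = nonzeroSquare r r≢0 z≋r²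
  where
  r = residue p a
  lemma : ∀ z r → z - r * r + r * r ≡ z
  lemma = solve-∀
  z≋r² : z ≋ rep r * rep r [mod p ]
  z≋r² = square-resp z a (rep r) z≋a² (≋-residue p a)
  r≢0 : toℕ r ≢ 0
  r≢0 r≡0 = unitSquare⇒∤ p≢1 u (∣-resp-≡ (lemma z (rep r))
    (∣m∣n⇒∣m+n z≋r² (∣m⇒∣m*n (rep r) (divides 0ℤ (cong +_ r≡0)))))

-- A clique x , y , … of Gₚ enters through its successive differences x - y , …,
-- which suffice because the remaining differences are sums of consecutive ones.
TriangleFree : ℕ → Set
TriangleFree p = ∀ (a b : Fin p) → NonzeroSquare p (rep a) → NonzeroSquare p (rep b) →
  ¬ NonzeroSquare p (rep a + rep b)

-- The conditions on `a` and `b` precede the quantifier over `c`, so the decision procedure tries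
-- `c` only after finding a triangle.
K₄Free : ℕ → Set
K₄Free p = ∀ (a b : Fin p) → NonzeroSquare p (rep a) → NonzeroSquare p (rep b) →
  NonzeroSquare p (rep a + rep b) → ∀ (c : Fin p) → NonzeroSquare p (rep c) →
  NonzeroSquare p (rep b + rep c) → ¬ NonzeroSquare p (rep a + rep b + rep c)

triangleFree? : ∀ p → Dec (TriangleFree p)
triangleFree? p = all? λ a → all? λ b → nonzeroSquare? p _ →-dec nonzeroSquare? p _ →-dec
  ¬? (nonzeroSquare? p _)

K₄free? : ∀ p → Dec (K₄Free p)
K₄free? p = all? λ a → all? λ b → nonzeroSquare? p _ →-dec nonzeroSquare? p _ →-dec
  nonzeroSquare? p _ →-dec (all? λ c → nonzeroSquare? p _ →-dec nonzeroSquare? p _ →-dec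
  ¬? (nonzeroSquare? p _))

-- The nonzero squares modulo 5 are 1 and 4, and their pairwise sums are 2, 0 and 3.
triangleFree-5 : TriangleFree 5
triangleFree-5 = from-yes (triangleFree? 5)

K₄free-13 : K₄Free 13
K₄free-13 = from-yes (K₄free? 13)

K₄free-17 : K₄Free 17
K₄free-17 = from-yes (K₄free? 17)

-- Cliques of Gₙ reduced modulo a divisor of n

module _ {n p : ℕ} .{{_ : NonZero p}} (p≢1 : p ≢ 1) (p∣n : p ℕ∣.∣ n) where

  private
    difference : ∀ (x y : Fin n) {z} → rep x - rep y ≋ z [mod p ] → PaleyAdj n x y →
      NonzeroSquare p z
    difference x y x-y≋z e = unitSquare⇒nonzeroSquare p≢1
      (unitSquare-resp x-y≋z (unitSquare-∣ p∣n (paleyAdj⇒unitSquare x y e)))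

    _⊖_ : Fin n → Fin n → Fin p
    x ⊖ y = residue p (rep x - rep y)

    ≋-⊖ : ∀ (x y : Fin n) → rep x - rep y ≋ rep (x ⊖ y) [mod p ]
    ≋-⊖ x y = ≋-residue p (rep x - rep y)

    -- Differences telescope. The integer `a` is arbitrary so that the step can be iterated along
    -- four vertices.
    ≋-⊖-+ : ∀ (x y z : Fin n) {a} → rep x - rep y ≋ a [mod p ] →
      rep x - rep z ≋ a + rep (y ⊖ z) [mod p ]
    ≋-⊖-+ x y z {a} x-y≋a = ∣-resp-≡ (lemma (rep x) (rep y) (rep z) a (rep (y ⊖ z)))
      (∣m∣n⇒∣m+n x-y≋a (≋-⊖ y z))
      where
      lemma : ∀ x y z a b → x - y - a + (y - z - b) ≡ x - z - (a + b)
      lemma = solve-∀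

    ≋-⊖₂ : ∀ x y z → rep x - rep z ≋ rep (x ⊖ y) + rep (y ⊖ z) [mod p ]
    ≋-⊖₂ x y z = ≋-⊖-+ x y z {rep (x ⊖ y)} (≋-⊖ x y)

    ≋-⊖₃ : ∀ x y z w →
      rep x - rep w ≋ rep (x ⊖ y) + rep (y ⊖ z) + rep (z ⊖ w) [mod p ]
    ≋-⊖₃ x y z w = ≋-⊖-+ x z w {rep (x ⊖ y) + rep (y ⊖ z)} (≋-⊖₂ x y z)

  paley-triangleFree : TriangleFree p → ∀ x y z →
    PaleyAdj n x y → PaleyAdj n x z → PaleyAdj n y z → ⊥
  paley-triangleFree free x y z xy xz yz =
    free (x ⊖ y) (y ⊖ z) (difference x y (≋-⊖ x y) xy) (difference y z (≋-⊖ y z) yz)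
      (difference x z (≋-⊖₂ x y z) xz)

  paley-K₄free : K₄Free p → ∀ x y z w →
    PaleyAdj n x y → PaleyAdj n x z → PaleyAdj n x w →
    PaleyAdj n y z → PaleyAdj n y w → PaleyAdj n z w → ⊥
  paley-K₄free free x y z w xy xz xw yz yw zw =
    free (x ⊖ y) (y ⊖ z) (difference x y (≋-⊖ x y) xy) (difference y z (≋-⊖ y z) yz)
      (difference x z (≋-⊖₂ x y z) xz) (z ⊖ w) (difference z w (≋-⊖ z w) zw)
      (difference y w (≋-⊖₂ y z w) yw) (difference x w (≋-⊖₃ x y z w) xw)

-- Cliques as lists

-- In a list, a clique that is too large is exposed by matching on its first three or four entries,
-- with one orientation of each edge at hand.
clique⇒list : ∀ {n} {E : Rel (Fin n) 0ℓ} S → IsClique E S →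
  ∃[ xs ] All (_∈ S) xs × AllPairs E xs × length xs ≡ Subset.∣ S ∣
clique⇒list [] _ = [] , [] , [] , refl
clique⇒list {E = E} (s ∷ S) clique
  with xs , xs⊆S , adj , len ← clique⇒list {E = λ x y → E (suc x) (suc y)} S
         (λ x∈ y∈ x≢y → clique (there x∈) (there y∈) (x≢y ∘ suc-injective))
  with s
... | outside = map suc xs , All.map⁺ (All.map there xs⊆S) , AllPairs.map⁺ adj ,
  trans (length-map suc xs) len
... | inside = zero ∷ map suc xs , here ∷ All.map⁺ (All.map there xs⊆S) ,
  All.map⁺ (All.map (λ x∈ → clique here (there x∈) λ ()) xs⊆S) ∷ AllPairs.map⁺ adj ,
  cong suc (trans (length-map suc xs) len)

insert-∣∣ : ∀ {n} (S : Subset n) {x} → x ∉ S → Subset.∣ S [ x ]≔ inside ∣ ≡ suc Subset.∣ S ∣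
insert-∣∣ (outside ∷ S) {zero} _ = refl
insert-∣∣ (inside ∷ S) {zero} x∉ = contradiction here x∉
insert-∣∣ (outside ∷ S) {suc x} x∉ = insert-∣∣ S (x∉ ∘ there)
insert-∣∣ (inside ∷ S) {suc x} x∉ = cong suc (insert-∣∣ S (x∉ ∘ there))

∈-insert⁻ : ∀ {n} (S : Subset n) {x y} → y ∈ S [ x ]≔ inside → y ≡ x ⊎ y ∈ S
∈-insert⁻ (s ∷ S) {zero} here = inj₁ refl
∈-insert⁻ (s ∷ S) {zero} (there y∈) = inj₂ (there y∈)
∈-insert⁻ (s ∷ S) {suc x} here = inj₂ here
∈-insert⁻ (s ∷ S) {suc x} (there y∈) = Sum.map (cong suc) there (∈-insert⁻ S y∈)

-- The inclusion of `S` in `xs` is carried through the induction so that the conditions on the head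
-- can be looked up for members of `S`.
list⇒clique : ∀ {n} {E : Rel (Fin n) 0ℓ} xs →
  AllPairs (λ x y → x ≢ y × E x y × E y x) xs →
  ∃[ S ] (∀ {x} → x ∈ S → x ∈ˡ xs) × IsClique E S × Subset.∣ S ∣ ≡ length xs
list⇒clique {n} [] [] = Subset.⊥ , (λ x∈ → contradiction x∈ ∉⊥) ,
  (λ x∈ → contradiction x∈ ∉⊥) , ∣⊥∣≡0 n
list⇒clique {E = E} (x ∷ xs) (adj ∷ adjs)
  with S , S⊆xs , clique , card ← list⇒clique {E = E} xs adjs
  = S [ x ]≔ inside , [ here , there ∘ S⊆xs ]′ ∘ ∈-insert⁻ S , clique′ ,
    trans (insert-∣∣ S λ x∈ → proj₁ (All.lookup adj (S⊆xs x∈)) refl) (cong suc card)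
  where
  clique′ : IsClique E (S [ x ]≔ inside)
  clique′ u∈ v∈ u≢v with ∈-insert⁻ S u∈ | ∈-insert⁻ S v∈
  ... | inj₁ refl | inj₁ refl = contradiction refl u≢v
  ... | inj₁ refl | inj₂ v∈S = proj₁ (proj₂ (All.lookup adj (S⊆xs v∈S)))
  ... | inj₂ u∈S | inj₁ refl = proj₂ (proj₂ (All.lookup adj (S⊆xs u∈S)))
  ... | inj₂ u∈S | inj₂ v∈S = clique u∈S v∈S u≢v

isCliqueNumber : ∀ {n} {E : Rel (Fin n) 0ℓ} {ω} xs →
  AllPairs (λ x y → x ≢ y × E x y × E y x) xs → length xs ≡ ω →
  (∀ ys → AllPairs E ys → length ys ≤ ω) → IsCliqueNumber E ω
isCliqueNumber {E = E} xs adj refl bound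
  with S , _ , clique , card ← list⇒clique {E = E} xs adj
  = (S , clique , card) , λ T T-clique →
    case clique⇒list T T-clique of λ { (ys , _ , adj′ , len) →
      subst (_≤ length xs) len (bound ys adj′) }

length≤2 : ∀ {A : Set} {E : Rel A 0ℓ} → (∀ x y z → E x y → E x z → E y z → ⊥) →
  ∀ xs → AllPairs E xs → length xs ≤ 2
length≤2 _ [] _ = z≤n
length≤2 _ (_ ∷ []) _ = s≤s z≤n
length≤2 _ (_ ∷ _ ∷ []) _ = s≤s (s≤s z≤n)
length≤2 free (x ∷ y ∷ z ∷ _) ((xy ∷ xz ∷ _) ∷ (yz ∷ _) ∷ _) =
  contradiction yz (free x y z xy xz)

length≤3 : ∀ {A : Set} {E : Rel A 0ℓ} →
  (∀ x y z w → E x y → E x z → E x w → E y z → E y w → E z w → ⊥) →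
  ∀ xs → AllPairs E xs → length xs ≤ 3
length≤3 _ [] _ = z≤n
length≤3 _ (_ ∷ []) _ = s≤s z≤n
length≤3 _ (_ ∷ _ ∷ []) _ = s≤s (s≤s z≤n)
length≤3 _ (_ ∷ _ ∷ _ ∷ []) _ = s≤s (s≤s (s≤s z≤n))
length≤3 free (x ∷ y ∷ z ∷ w ∷ _)
  ((xy ∷ xz ∷ xw ∷ _) ∷ (yz ∷ yw ∷ _) ∷ (zw ∷ _) ∷ _) =
  contradiction zw (free x y z w xy xz xw yz yw)

corollary1p8 : ∀ (n k : ℕ) (p α : Fin k → ℕ) →
    k ≥ 1 →
    (∀ i → Prime (p i)) →
    Injective _≡_ _≡_ p →
    (∀ i → p i % 4 ≡ 1) →
    (∀ i → α i ≥ 1) →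
    n ≡ primePowerProduct p α →
    ((∃[ i ] p i ≡ 5) → IsCliqueNumber (PaleyAdj n) 2)
    × ((∃[ i ] (p i ≡ 13 ⊎ p i ≡ 17)) → 5 ∤ n → IsCliqueNumber (PaleyAdj n) 3)
corollary1p8 n k p α _ prime _ p%4≡1 α≥1 n≡ = part₁ , part₂
  where
  minusOne : MinusOneSquare n
  minusOne = subst MinusOneSquare (sym n≡)
    -- Modulo 1 any integer is a root of -1; 0 is taken.
    (primePowerProduct-induction MinusOneSquare (0ℤ , ∣ᵤ⇒∣ (ℕ∣.1∣ 1)) p α
      λ i → minusOneSquare-prime-* (prime i) (p%4≡1 i))

  p∣n : ∀ i → p i ℕ∣.∣ n
  p∣n i = subst (p i ℕ∣.∣_) (sym n≡) (factor-∣-primePowerProduct p α i (α≥1 i))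

  prime∤n : ∀ {q} → Prime q → (∀ i → q ≢ p i) → q ∤ n
  prime∤n {q} pq q≢p = subst (q ∤_) (sym n≡)
    (primePowerProduct-induction (q ∤_) (prime∤1 pq) p α λ i {m} q∤m q∣pm →
      [ prime∤prime (prime i) pq (q≢p i) , q∤m ]′ (euclidsLemma (p i) m pq q∣pm))

  -- Neither 2 nor 3 is congruent to 1 modulo 4, so neither is among the `p i`.
  2∤n : 2 ∤ n
  2∤n = prime∤n (from-yes (prime? 2)) λ i 2≡p →
    case trans (cong (_% 4) 2≡p) (p%4≡1 i) of λ ()

  3∤n : 3 ∤ n
  3∤n = prime∤n (from-yes (prime? 3)) λ i 3≡p →
    case trans (cong (_% 4) 3≡p) (p%4≡1 i) of λ ()

  instance
    n-nonZero : NonZero n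
    n-nonZero = ℕ.≢-nonZero λ n≡0 → 2∤n (subst (2 ℕ∣.∣_) (sym n≡0) (2 ℕ∣.∣0))

  n≢1 : Fin k → n ≢ 1
  n≢1 i n≡1 = prime∤1 (prime i) (subst (p i ℕ∣.∣_) n≡1 (p∣n i))

  -- The index witnesses that `n` is not 1, which makes adjacent vertices distinct.
  adjacent : Fin k → ∀ z w → UnitSquare n (z - w) →
    residue n z ≢ residue n w ×
    PaleyAdj n (residue n z) (residue n w) × PaleyAdj n (residue n w) (residue n z)
  adjacent i z w u = paleyAdj⇒≢ (n≢1 i) e , e ,
    paleyAdj-residue w z (subst (UnitSquare n) (lemma z w) (unitSquare-neg minusOne u))
    where
    e = paleyAdj-residue z w u
    lemma : ∀ z w → - (z - w) ≡ w - z
    lemma = solve-∀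

  unit-1 : Unit n 1ℤ
  unit-1 = unit 1ℤ (divides 0ℤ refl)

  primeUnit : ∀ {q} → Prime q → q ∤ n → Unit n (+ q)
  primeUnit pq q∤n = coprime⇒unit (∤⇒coprime pq q∤n)

  part₁ : (∃[ i ] p i ≡ 5) → IsCliqueNumber (PaleyAdj n) 2
  part₁ (i , p≡5) = isCliqueNumber {E = PaleyAdj n} (residue n 1ℤ ∷ residue n 0ℤ ∷ [])
    ((adjacent i 1ℤ 0ℤ (unit⇒unitSquare unit-1) ∷ []) ∷ [] ∷ []) refl
    (length≤2 (paley-triangleFree {p = 5} (λ ()) (subst (ℕ∣._∣ n) p≡5 (p∣n i)) triangleFree-5))

  part₂ : (∃[ i ] (p i ≡ 13 ⊎ p i ≡ 17)) → 5 ∤ n → IsCliqueNumber (PaleyAdj n) 3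
  part₂ (i , p≡13⊎17) 5∤n =
    -- The differences are 16 = (2 · 2)², 25 = 5² and 9 = 3². Residues are taken because `n` may be
    -- as small as 13.
    isCliqueNumber {E = PaleyAdj n} (residue n (+ 25) ∷ residue n (+ 9) ∷ residue n 0ℤ ∷ [])
      ((adjacent i (+ 25) (+ 9) (unit⇒unitSquare (unit-* unit-2 unit-2))
         ∷ adjacent i (+ 25) 0ℤ (unit⇒unitSquare (primeUnit (from-yes (prime? 5)) 5∤n)) ∷ [])
       ∷ (adjacent i (+ 9) 0ℤ (unit⇒unitSquare (primeUnit (from-yes (prime? 3)) 3∤n)) ∷ [])
       ∷ [] ∷ []) refl
      (length≤3 (K₄free p≡13⊎17))
    where
    unit-2 : Unit n (+ 2)
    unit-2 = primeUnit (from-yes (prime? 2)) 2∤n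
    K₄free : p i ≡ 13 ⊎ p i ≡ 17 → ∀ x y z w →
      PaleyAdj n x y → PaleyAdj n x z → PaleyAdj n x w →
      PaleyAdj n y z → PaleyAdj n y w → PaleyAdj n z w → ⊥
    K₄free (inj₁ p≡13) = paley-K₄free (λ ()) (subst (ℕ∣._∣ n) p≡13 (p∣n i)) K₄free-13
    K₄free (inj₂ p≡17) = paley-K₄free (λ ()) (subst (ℕ∣._∣ n) p≡17 (p∣n i)) K₄free-17
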